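{- Let $a$ be a weak composition of length $n$. Then \[\mathcal{A}_a=\sum_{S\in\mathrm{HSSF}(a)}\mathfrak{L}_{\mathrm{wt}(S)}.\]
   Context: $D(a)$: $a_i$ left-justified boxes in row $i$, row 1 lowest, columns numbered from the left. For a filling $S$, $\mathrm{wt}(S)$ is the weak composition of length $n$ whose $i$th part is the number of entries $i$. Triples (rows $r<s$): Type A: $\gamma=(r,c),\alpha=(r,c+1),\beta=(s,c+1)$ with $a_r\ge a_s$; Type B: $\gamma=(s,c),\alpha=(s,c+1),\beta=(r,c)$ with $a_s>a_r$; inversion triple: $\beta>\gamma\ge\alpha$ or $\gamma\ge\alpha>\beta$. $\mathcal{A}\mathrm{SSF}(a)$ is the set of fillings of $D(a)$ with positive integers, rows weakly decreasing left to right, distinct entries in each column, all triples inversion triples, and first-column entry of each nonempty row $i$ equal to $i$; $\mathcal{A}_a=\sum_{S\in\mathcal{A}\mathrm{SSF}(a)}x^{\mathrm{wt}(S)}$. $S\in\mathcal{A}\mathrm{SSF}(a)$ is particle-highest if for every entry value $i$ appearing in $S$, either the leftmost occurrence of $i$ is in the first column, or some occurrence of $i^\uparrow$ lies in a column weakly right of the leftmost $i$, where $i^\uparrow$ is the smallest entry of $S$ larger than $i$. $\mathrm{HSSF}(a)$ is the set of particle-highest elements of $\mathcal{A}\mathrm{SSF}(a)$. Fixed slides: a local move replaces consecutive entries $(0,k)$ at positions $p,p+1$ of a weak composition by $(i,j)$ with $i+j=k$, $i,j\ge0$; a fixed slide of $b$ is obtained from $b$ by a (possibly empty) sequence of such moves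 where $j>0$ is required whenever $b_{p+1}\neq 0$. $\mathfrak{L}_b=\sum x^{c}$ over the set of fixed slides $c$ of $b$. -}

module Defs where

open import Data.Bool.Base using (if_then_else_)
open import Data.Empty using (⊥-elim)
open import Data.Fin.Base as Fin using (Fin; zero; suc; toℕ)
import Data.Fin.Properties as Fin
open import Data.Integer.Base as ℤ using (ℤ; 0ℤ; 1ℤ)
open import Data.List.Base as List using (List; []; _∷_; _++_; concatMap)
open import Data.List.Membership.Propositional using (_∈_; find; lose)
import Data.List.Membership.Propositional.Properties as ∈
import Data.List.Relation.Unary.Any as Any
open import Data.List.Relation.Unary.Unique.Propositional using (Unique)
import Data.List.Relation.Unary.Unique.DecPropositional.Properties as Unique
open import Data.Nat.Base using (ℕ; zero; suc; _+_; _∸_; _≤_; _<_; _>_; _≥_; z≤n; s≤s)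
open import Data.Nat.Properties as ℕ using (_≟_; _≤?_; _<?_)
open import Data.Product.Base using (∃-syntax; _×_; _,_; proj₁; proj₂; uncurry)
open import Data.Sum.Base using (_⊎_; inj₁; inj₂)
open import Data.Vec.Base as Vec using (Vec; []; _∷_; lookup; tabulate)
import Data.Vec.Properties as Vec
open import Data.Vec.Relation.Unary.All using (All; []; _∷_)
open import Relation.Binary.Construct.Closure.ReflexiveTransitive using (Star; ε; _◅_)
open import Relation.Binary.Definitions using (DecidableEquality)
open import Relation.Binary.PropositionalEquality
  using (_≡_; _≢_; refl; sym; cong; cong₂; subst)
open import Relation.Nullary.Decidable
  using (Dec; yes; no; does; map′; _×-dec_; _⊎-dec_; _→-dec_; ¬?)
open import Relation.Unary using (Decidable)

------------------------------------------------------------------------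
-- Finite sets and polynomials

record FiniteSet {A : Set} (P : A → Set) : Set where
  field
    elements : List A
    unique   : Unique elements
    sound    : ∀ {x} → x ∈ elements → P x
    complete : ∀ {x} → P x → x ∈ elements

open FiniteSet public

WeakComposition : ℕ → Set
WeakComposition n = Vec ℕ n

_≟ᵥ_ : ∀ {n} → DecidableEquality (Vec ℕ n)
_≟ᵥ_ = Vec.≡-dec _≟_

-- Elements of ℤ[x₁,…,xₙ], presented as formal sums of terms
-- (coefficient , exponent vector); two presentations are identified by _≈_
-- when every monomial has the same total coefficient in both.
Polynomial : ℕ → Set
Polynomial n = List (ℤ × WeakComposition n)

coeff : ∀ {n} → Polynomial n → WeakComposition n → ℤ
coeff []            e = 0ℤ
coeff ((k , c) ∷ p) e =
  (if does (c ≟ᵥ e) then k else 0ℤ) ℤ.+ coeff p e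

infix 4 _≈_
_≈_ : ∀ {n} → Polynomial n → Polynomial n → Set
p ≈ q = ∀ e → coeff p e ≡ coeff q e

x^_ : ∀ {n} → WeakComposition n → Polynomial n
x^ c = (1ℤ , c) ∷ []

∑ : ∀ {A : Set} {P : A → Set} {n} → FiniteSet P → (A → Polynomial n) → Polynomial n
∑ X f = concatMap f (elements X)

infix 5 ∑
syntax ∑ X (λ x → p) = ∑[ x ∈ X ] p

------------------------------------------------------------------------
-- Fillings of the diagram D(a)

-- Rows and columns are numbered from 0: cell i c is the box in row i + 1
-- (from the bottom) and column c + 1 (from the left).
record Cell {n} (a : WeakComposition n) : Set where
  constructor cell
  field
    row    : Fin n
    column : Fin (lookup a row)

  col : ℕ
  col = toℕ column

open Cell public

-- A vector of length aᵢ for each row i.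
Filling : ∀ {n} → WeakComposition n → Set
Filling a = All (Vec ℕ) a

entry : ∀ {n} {a : WeakComposition n} → Filling a → Cell a → ℕ
entry (r ∷ S) (cell zero    c) = lookup r c
entry (r ∷ S) (cell (suc i) c) = entry S (cell i c)

occurrences : ∀ {n} {a : WeakComposition n} → ℕ → Filling a → ℕ
occurrences v []      = 0
occurrences v (r ∷ S) = Vec.count (_≟ v) r + occurrences v S

wt : ∀ {n} {a : WeakComposition n} → Filling a → WeakComposition n
wt S = tabulate λ i → occurrences (suc (toℕ i)) S

-- γ and α are horizontally adjacent, γ on the left.
Adjacent : ∀ {n} {a : WeakComposition n} → Cell a → Cell a → Set
Adjacent γ α = row γ ≡ row α × col α ≡ suc (col γ)

TypeA : ∀ {n} (a : WeakComposition n) → (γ α β : Cell a) → Set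
TypeA a γ α β =
  Adjacent γ α × row γ Fin.< row β × col β ≡ col α × lookup a (row γ) ≥ lookup a (row β)

TypeB : ∀ {n} (a : WeakComposition n) → (γ α β : Cell a) → Set
TypeB a γ α β =
  Adjacent γ α × row β Fin.< row γ × col β ≡ col γ × lookup a (row γ) > lookup a (row β)

-- The arguments are the entries in the boxes γ, α, β.
Inversion : (γ α β : ℕ) → Set
Inversion γ α β = (β > γ × γ ≥ α) ⊎ (γ ≥ α × α > β)

record IsASSF {n} (a : WeakComposition n) (S : Filling a) : Set where
  field
    positive        : ∀ x → entry S x > 0
    rows-decreasing : ∀ x y → row x ≡ row y → col x ≤ col y → entry S x ≥ entry S y
    column-distinct : ∀ x y → col x ≡ col y → x ≢ y → entry S x ≢ entry S y
    triples         : ∀ γ α β → TypeA a γ α β ⊎ TypeB a γ α β →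
                      Inversion (entry S γ) (entry S α) (entry S β)
    first-column    : ∀ x → col x ≡ 0 → entry S x ≡ suc (toℕ (row x))

Appears : ∀ {n} {a : WeakComposition n} → Filling a → ℕ → Set
Appears S v = ∃[ x ] entry S x ≡ v

-- The box x holds the leftmost occurrence of its entry.
Leftmost : ∀ {n} {a : WeakComposition n} → Filling a → Cell a → Set
Leftmost S x = ∀ y → entry S y ≡ entry S x → col x ≤ col y

-- j = i↑
IsUp : ∀ {n} {a : WeakComposition n} → Filling a → (i j : ℕ) → Set
IsUp S i j = Appears S j × i < j × (∀ k → Appears S k → i < k → j ≤ k)

ParticleHighest : ∀ {n} {a : WeakComposition n} → Filling a → Set
ParticleHighest S =
  ∀ x → Leftmost S x →
  col x ≡ 0 ⊎ (∃[ y ] IsUp S (entry S x) (entry S y) × col x ≤ col y)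

IsHSSF : ∀ {n} (a : WeakComposition n) → Filling a → Set
IsHSSF a S = IsASSF a S × ParticleHighest S

------------------------------------------------------------------------
-- Fixed slides

-- Move b u v: a local move from u to v that is allowed for fixed slides of b.
-- The condition j > 0 refers to the original composition b, not to u.
data Move : ∀ {n} → (b u v : WeakComposition n) → Set where
  here  : ∀ {n} {b u : WeakComposition n} {b₁ b₂ k i j} →
          i + j ≡ k → (b₂ ≢ 0 → j > 0) →
          Move (b₁ ∷ b₂ ∷ b) (0 ∷ k ∷ u) (i ∷ j ∷ u)
  there : ∀ {n} {b u v : WeakComposition n} {b₁ x} →
          Move b u v → Move (b₁ ∷ b) (x ∷ u) (x ∷ v)

IsFixedSlide : ∀ {n} → (b c : WeakComposition n) → Set
IsFixedSlide b c = Star (Move b) b c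

------------------------------------------------------------------------
-- Finiteness of the set of fixed slides

allowed? : ∀ b₂ k → Decidable (λ i → b₂ ≢ 0 → k ∸ i > 0)
allowed? b₂ k i = ¬? (b₂ ≟ 0) →-dec (0 <? k ∸ i)

split : ∀ {n} → ℕ → WeakComposition n → ℕ → WeakComposition (2 + n)
split k u i = i ∷ (k ∸ i) ∷ u

splits : ∀ {n} → ℕ → ℕ → WeakComposition n → List (WeakComposition (2 + n))
splits b₂ k u = List.map (split k u) (List.filter (allowed? b₂ k) (List.upTo (suc k)))

moves : ∀ {n} → (b u : WeakComposition n) → List (WeakComposition n)
moves []            []              = []
moves (_ ∷ [])      (_ ∷ [])        = []
moves (b₁ ∷ b₂ ∷ b) (zero ∷ k ∷ u)  =
  splits b₂ k u ++ List.map (zero ∷_) (moves (b₂ ∷ b) (k ∷ u))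
moves (b₁ ∷ b₂ ∷ b) (suc x ∷ k ∷ u) =
  List.map (suc x ∷_) (moves (b₂ ∷ b) (k ∷ u))

splits-sound : ∀ {n} {b₁ b₂ k} {b u : WeakComposition n} {v} →
               v ∈ splits b₂ k u → Move (b₁ ∷ b₂ ∷ b) (zero ∷ k ∷ u) v
splits-sound {b₂ = b₂} {k} {u = u} v∈ with i , i∈ , refl ← ∈.∈-map⁻ (split k u) v∈
  with i∈′ , pos ← ∈.∈-filter⁻ (allowed? b₂ k) {xs = List.upTo (suc k)} i∈ =
  here (ℕ.m+[n∸m]≡n (ℕ.≤-pred (∈.∈-upTo⁻ i∈′))) pos

moves-sound : ∀ {n} (b u : WeakComposition n) {v} → v ∈ moves b u → Move b u v
moves-sound []            []            ()
moves-sound (_ ∷ [])      (_ ∷ [])      ()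
moves-sound (b₁ ∷ b₂ ∷ b) (zero ∷ k ∷ u) v∈ with ∈.∈-++⁻ (splits b₂ k u) v∈
... | inj₁ v∈ˡ = splits-sound v∈ˡ
... | inj₂ v∈ʳ with _ , w∈ , refl ← ∈.∈-map⁻ (zero ∷_) v∈ʳ =
  there (moves-sound (b₂ ∷ b) (k ∷ u) w∈)
moves-sound (b₁ ∷ b₂ ∷ b) (suc x ∷ k ∷ u) v∈
  with _ , w∈ , refl ← ∈.∈-map⁻ (suc x ∷_) v∈ = there (moves-sound (b₂ ∷ b) (k ∷ u) w∈)

splits-complete : ∀ {n} {b₂ k i j} {u : WeakComposition n} →
                  i + j ≡ k → (b₂ ≢ 0 → j > 0) → (i ∷ j ∷ u) ∈ splits b₂ k u
splits-complete {b₂ = b₂} {i = i} {j} {u} refl pos =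
  subst (λ j′ → (i ∷ j′ ∷ u) ∈ splits b₂ (i + j) u) eq
    (∈.∈-map⁺ (split (i + j) u) (∈.∈-filter⁺ (allowed? b₂ (i + j))
      (∈.∈-upTo⁺ (s≤s (ℕ.m≤m+n i j)))
      (λ b₂≢0 → subst (0 <_) (sym eq) (pos b₂≢0))))
  where
  eq : i + j ∸ i ≡ j
  eq = ℕ.m+n∸m≡n i j

moves-complete : ∀ {n} {b u v : WeakComposition n} → Move b u v → v ∈ moves b u
moves-complete (here eq pos) = ∈.∈-++⁺ˡ (splits-complete eq pos)
moves-complete {b = _ ∷ []}     {_ ∷ []}       (there ())
moves-complete {b = _ ∷ b₂ ∷ _} {zero ∷ k ∷ u}  (there m) =
  ∈.∈-++⁺ʳ (splits b₂ k u) (∈.∈-map⁺ (zero ∷_) (moves-complete m))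
moves-complete {b = _ ∷ _ ∷ _}  {suc x ∷ _ ∷ _} (there m) =
  ∈.∈-map⁺ (suc x ∷_) (moves-complete m)

μ : ∀ {n} → WeakComposition n → ℕ
μ []      = 0
μ (_ ∷ u) = Vec.sum u + μ u

sum-move : ∀ {n} {b u v : WeakComposition n} → Move b u v → Vec.sum v ≡ Vec.sum u
sum-move (here {i = i} {j} refl _) = sym (ℕ.+-assoc i j _)
sum-move (there {x = x} m)         = cong (x +_) (sum-move m)

μ-move : ∀ {n} {b u v : WeakComposition n} → Move b u v → u ≡ v ⊎ μ v < μ u
μ-move (here {i = zero} refl _) = inj₁ refl
μ-move (here {u = u} {i = suc i} {j} refl _) =
  inj₂ (ℕ.+-monoˡ-< (Vec.sum u + μ u) (ℕ.+-monoˡ-< (Vec.sum u) (s≤s (ℕ.m≤n+m j i))))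
μ-move (there {u = u} {v} {x = x} m) with μ-move m
... | inj₁ refl = inj₁ refl
... | inj₂ lt   = inj₂ (subst (λ s → s + μ v < Vec.sum u + μ u) (sym (sum-move m))
                         (ℕ.+-monoʳ-< (Vec.sum u) lt))

reach : ∀ {n} → ℕ → (b u : WeakComposition n) → List (WeakComposition n)
reach zero    b u = u ∷ []
reach (suc f) b u = u ∷ concatMap (reach f b) (moves b u)

reach-sound : ∀ {n} f (b u : WeakComposition n) {c} → c ∈ reach f b u → Star (Move b) u c
reach-sound zero    b u (Any.here refl) = ε
reach-sound (suc f) b u (Any.here refl) = ε
reach-sound (suc f) b u (Any.there c∈)
  with v , v∈ , c∈′ ← find (∈.∈-concatMap⁻ (reach f b) c∈) =
  moves-sound b u v∈ ◅ reach-sound f b v c∈′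

reach-complete : ∀ {n} f {b u c : WeakComposition n} → μ u ≤ f → Star (Move b) u c → c ∈ reach f b u
reach-complete zero    μ≤ ε       = Any.here refl
reach-complete (suc f) μ≤ ε       = Any.here refl
reach-complete f       μ≤ (m ◅ s) with μ-move m
reach-complete f       μ≤ (m ◅ s) | inj₁ refl = reach-complete f μ≤ s
reach-complete zero    μ≤ (m ◅ s) | inj₂ lt   = ⊥-elim (ℕ.n≮0 (ℕ.<-≤-trans lt μ≤))
reach-complete (suc f) {b} μ≤ (m ◅ s) | inj₂ lt =
  Any.there (∈.∈-concatMap⁺ (reach f b)
    (lose (moves-complete m) (reach-complete f (ℕ.≤-pred (ℕ.<-≤-trans lt μ≤)) s)))

FS : ∀ {n} (b : WeakComposition n) → FiniteSet (IsFixedSlide b)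
FS b = record
  { elements = List.deduplicate _≟ᵥ_ (reach (μ b) b b)
  ; unique   = Unique.deduplicate-! _≟ᵥ_ _
  ; sound    = λ c∈ → reach-sound (μ b) b b (∈.∈-deduplicate⁻ _≟ᵥ_ _ c∈)
  ; complete = λ s → ∈.∈-deduplicate⁺ _≟ᵥ_ (reach-complete (μ b) ℕ.≤-refl s)
  }

------------------------------------------------------------------------
-- Finiteness of ASSF(a) and HSSF(a)

_≟ꟳ_ : ∀ {n} {a : WeakComposition n} → DecidableEquality (Filling a)
[]      ≟ꟳ []      = yes refl
(r ∷ S) ≟ꟳ (t ∷ T) =
  map′ (uncurry (cong₂ _∷_)) (λ { refl → refl , refl }) ((r ≟ᵥ t) ×-dec (S ≟ꟳ T))

rows≤ : ℕ → (m : ℕ) → List (Vec ℕ m)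
rows≤ N zero    = [] ∷ []
rows≤ N (suc m) = List.cartesianProductWith _∷_ (List.upTo (suc N)) (rows≤ N m)

fillings≤ : ∀ {n} → ℕ → (a : WeakComposition n) → List (Filling a)
fillings≤ N []      = [] ∷ []
fillings≤ N (m ∷ a) = List.cartesianProductWith _∷_ (rows≤ N m) (fillings≤ N a)

rows≤-complete : ∀ {N m} (r : Vec ℕ m) → (∀ c → lookup r c ≤ N) → r ∈ rows≤ N m
rows≤-complete []      h = Any.here refl
rows≤-complete (x ∷ r) h =
  ∈.∈-cartesianProductWith⁺ _∷_ (∈.∈-upTo⁺ (s≤s (h zero))) (rows≤-complete r (λ c → h (suc c)))

fillings≤-complete : ∀ {n N} {a : WeakComposition n} (S : Filling a) →
                     (∀ x → entry S x ≤ N) → S ∈ fillings≤ N a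
fillings≤-complete []      h = Any.here refl
fillings≤-complete (r ∷ S) h =
  ∈.∈-cartesianProductWith⁺ _∷_ (rows≤-complete r (λ c → h (cell zero c)))
    (fillings≤-complete S (λ (cell i c) → h (cell (suc i) c)))

leftmost-in-row : ∀ {m} (c : Fin m) → ∃[ c₀ ] toℕ {m} c₀ ≡ 0
leftmost-in-row zero    = zero , refl
leftmost-in-row (suc _) = zero , refl

ASSF-bounded : ∀ {n} {a : WeakComposition n} {S} → IsASSF a S → ∀ x → entry S x ≤ n
ASSF-bounded {n} {S = S} p x@(cell i c) with c₀ , c₀≡0 ← leftmost-in-row c = begin
  entry S x        ≤⟨ rows-decreasing (cell i c₀) x refl (subst (_≤ toℕ c) (sym c₀≡0) z≤n) ⟩
  entry S (cell i c₀) ≡⟨ first-column (cell i c₀) c₀≡0 ⟩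
  suc (toℕ i)      ≤⟨ Fin.toℕ<n i ⟩
  n                ∎
  where
  open IsASSF p
  open ℕ.≤-Reasoning

module _ {n : ℕ} {a : WeakComposition n} where

  _≟ᶜ_ : DecidableEquality (Cell a)
  cell i c ≟ᶜ cell j d with i Fin.≟ j
  ... | no i≢j   = no λ { refl → i≢j refl }
  ... | yes refl = map′ (λ { refl → refl }) (λ { refl → refl }) (c Fin.≟ d)

  ∀ᶜ? : {P : Cell a → Set} → Decidable P → Dec (∀ x → P x)
  ∀ᶜ? P? = map′ (λ h (cell i c) → h i c) (λ h i c → h (cell i c))
             (Fin.all? λ i → Fin.all? λ c → P? (cell i c))

  ∃ᶜ? : {P : Cell a → Set} → Decidable P → Dec (∃[ x ] P x)
  ∃ᶜ? P? = map′ (λ (i , c , p) → cell i c , p) (λ (cell i c , p) → i , c , p)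
             (Fin.any? λ i → Fin.any? λ c → P? (cell i c))

  adjacent? : (γ α : Cell a) → Dec (Adjacent γ α)
  adjacent? γ α = (row γ Fin.≟ row α) ×-dec (col α ≟ suc (col γ))

  typeA? : ∀ γ α β → Dec (TypeA a γ α β)
  typeA? γ α β = adjacent? γ α ×-dec (row γ Fin.<? row β) ×-dec (col β ≟ col α)
                 ×-dec (lookup a (row β) ≤? lookup a (row γ))

  typeB? : ∀ γ α β → Dec (TypeB a γ α β)
  typeB? γ α β = adjacent? γ α ×-dec (row β Fin.<? row γ) ×-dec (col β ≟ col γ)
                 ×-dec (lookup a (row β) <? lookup a (row γ))

  inversion? : ∀ γ α β → Dec (Inversion γ α β)
  inversion? γ α β = ((γ <? β) ×-dec (α ≤? γ)) ⊎-dec ((α ≤? γ) ×-dec (β <? α))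

  isASSF? : Decidable (IsASSF a)
  isASSF? S = map′
    (λ (p , q , r , s , t) → record
      { positive = p ; rows-decreasing = q ; column-distinct = r ; triples = s ; first-column = t })
    (λ p → let open IsASSF p in
      positive , rows-decreasing , column-distinct , triples , first-column)
    ( (∀ᶜ? λ x → 0 <? entry S x)
    ×-dec (∀ᶜ? λ x → ∀ᶜ? λ y →
      (row x Fin.≟ row y) →-dec ((col x ≤? col y) →-dec (entry S y ≤? entry S x)))
    ×-dec (∀ᶜ? λ x → ∀ᶜ? λ y →
      (col x ≟ col y) →-dec (¬? (x ≟ᶜ y) →-dec ¬? (entry S x ≟ entry S y)))
    ×-dec (∀ᶜ? λ γ → ∀ᶜ? λ α → ∀ᶜ? λ β →
      (typeA? γ α β ⊎-dec typeB? γ α β) →-dec inversion? (entry S γ) (entry S α) (entry S β))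
    ×-dec (∀ᶜ? λ x → (col x ≟ 0) →-dec (entry S x ≟ suc (toℕ (row x)))))

  leftmost? : (S : Filling a) → Decidable (Leftmost S)
  leftmost? S x = ∀ᶜ? λ y → (entry S y ≟ entry S x) →-dec (col x ≤? col y)

  isUp? : (S : Filling a) → ∀ i j → Dec (IsUp S i j)
  isUp? S i j = (∃ᶜ? λ x → entry S x ≟ j) ×-dec (i <? j) ×-dec
    map′ (λ { h _ (x , refl) → h x }) (λ h x → h (entry S x) (x , refl))
      (∀ᶜ? λ x → (i <? entry S x) →-dec (j ≤? entry S x))

  particleHighest? : Decidable (ParticleHighest {a = a})
  particleHighest? S = ∀ᶜ? λ x → leftmost? S x →-dec ((col x ≟ 0) ⊎-dec
    (∃ᶜ? λ y → isUp? S (entry S x) (entry S y) ×-dec (col x ≤? col y)))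

  -- Every entry of a filling in ASSF(a) is at most n.
  filteredFillings : {P : Filling a → Set} → Decidable P → (∀ {S} → P S → IsASSF a S) → FiniteSet P
  filteredFillings P? P⇒ASSF = record
    { elements = List.deduplicate _≟ꟳ_ (List.filter P? (fillings≤ n a))
    ; unique   = Unique.deduplicate-! _≟ꟳ_ _
    ; sound    = λ S∈ → proj₂ (∈.∈-filter⁻ P? {xs = fillings≤ n a} (∈.∈-deduplicate⁻ _≟ꟳ_ _ S∈))
    ; complete = λ {S} p → ∈.∈-deduplicate⁺ _≟ꟳ_
        (∈.∈-filter⁺ P? (fillings≤-complete S (ASSF-bounded (P⇒ASSF p))) p)
    }

ASSF : ∀ {n} (a : WeakComposition n) → FiniteSet (IsASSF a)
ASSF a = filteredFillings isASSF? (λ p → p)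

HSSF : ∀ {n} (a : WeakComposition n) → FiniteSet (IsHSSF a)
HSSF a = filteredFillings (λ S → isASSF? S ×-dec particleHighest? S) proj₁

------------------------------------------------------------------------
-- The polynomials 𝒜ₐ and 𝔏_b

𝒜 : ∀ {n} → WeakComposition n → Polynomial n
𝒜 a = ∑[ S ∈ ASSF a ] x^ wt S

𝔏 : ∀ {n} → WeakComposition n → Polynomial n
𝔏 b = ∑[ c ∈ FS b ] x^ c

{-# OPTIONS --safe #-}
module Submission where

-- Read the cells of a filling by increasing entry, and from right to left among equal
-- entries.  All conditions defining ASSF(a), apart from positivity and the first column, only
-- compare the entry of a cell with one weakly to its right, and so depend on this order alone.
-- Raising each entry of T ∈ ASSF(a) to the next value at which the particle-highest condition
-- holds preserves the order, and gives merge T ∈ HSSF(a) with wt T a fixed slide of wt (merge T).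
-- Conversely S ∈ HSSF(a) and a fixed slide e of wt S determine T: cut the order of S into
-- consecutive runs of lengths e₁, e₂, ….  So T ↦ (merge T , wt T) is a bijection from ASSF(a)
-- onto the pairs (S , e) indexing the right-hand side.

open import Defs
open import Data.Bool.Base using (if_then_else_)
open import Data.Fin.Base as Fin using (Fin; zero; suc; toℕ; fromℕ<)
import Data.Fin.Properties as Fin
open import Data.Integer.Base as ℤ using (ℤ; 0ℤ; 1ℤ)
import Data.Integer.Properties as ℤ
open import Algebra.Properties.CommutativeSemigroup ℤ.+-commutativeSemigroup using (x∙yz≈y∙xz)
open import Data.List.Base as List using (List; []; _∷_; _++_; concatMap; filter; length; allFin)
import Data.List.Properties as List
open import Data.List.Membership.Propositional using (_∈_; find; lose)
import Data.List.Membership.Propositional.Properties as ∈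
import Data.List.Relation.Unary.All.Properties as ListAll
import Data.List.Relation.Binary.Permutation.Propositional.Properties as ↭
open import Data.List.Membership.Propositional.Properties.WithK using (unique∧set⇒bag)
open import Data.List.Relation.Binary.BagAndSetEquality using (∼bag⇒↭)
open import Data.List.Relation.Binary.Permutation.Propositional as ↭ using (_↭_)
open import Data.List.Relation.Unary.All as ListAll using ([]; _∷_)
open import Data.List.Relation.Unary.AllPairs using ([]; _∷_)
open import Data.List.Relation.Unary.Any using (here; there)
open import Data.List.Relation.Unary.Unique.Propositional using (Unique)
import Data.List.Relation.Unary.Unique.Propositional.Properties as Unique
open import Data.Nat.Base using (ℕ; zero; suc; _+_; _∸_; _≤_; _≥_; _<_; _>_; z≤n; s≤s)
open import Data.Nat.Properties as ℕ using (_≟_; _≤?_; _<?_)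
open import Data.Product.Base using (∃-syntax; _×_; _,_; proj₁; proj₂)
open import Data.Sum.Base as Sum using (_⊎_; inj₁; inj₂; [_,_]′)
open import Data.Vec.Base as Vec using ([]; _∷_; lookup; tabulate)
import Data.Vec.Properties as Vec
open import Data.Vec.Relation.Unary.All using ([]; _∷_)
open import Function.Base using (_∘_; id)
open import Function.Bundles using (_⇔_; mk⇔; Equivalence)
open import Function.Construct.Composition using (_⇔-∘_)
open import Function.Construct.Symmetry using (⇔-sym)
open import Relation.Binary.Construct.Closure.ReflexiveTransitive using (Star; ε; _◅_; _◅◅_; gmap)
open import Relation.Binary.Definitions using (tri<; tri≈; tri>)
open import Relation.Binary.PropositionalEquality
open import Relation.Nullary using (¬_; Dec; yes; no; contradiction)
open import Relation.Nullary.Decidable using (does; _×-dec_; _⊎-dec_)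
open import Relation.Unary using (Decidable)

-- Counting and searching

private variable
  A B : Set

count : {P : A → Set} → Decidable P → List A → ℕ
count P? = length ∘ filter P?

count-mono : {P Q : A → Set} (P? : Decidable P) (Q? : Decidable Q) → (∀ {x} → P x → Q x) →
             ∀ xs → count P? xs ≤ count Q? xs
count-mono P? Q? P⊆Q []       = z≤n
count-mono P? Q? P⊆Q (x ∷ xs) with P? x | Q? x
... | yes _ | yes _ = s≤s (count-mono P? Q? P⊆Q xs)
... | yes p | no ¬q = contradiction (P⊆Q p) ¬q
... | no _  | yes _ = ℕ.m≤n⇒m≤1+n (count-mono P? Q? P⊆Q xs)
... | no _  | no _  = count-mono P? Q? P⊆Q xs

count-cong : {P Q : A → Set} (P? : Decidable P) (Q? : Decidable Q) → (∀ {x} → P x ⇔ Q x) →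
             ∀ xs → count P? xs ≡ count Q? xs
count-cong P? Q? P⇔Q xs = ℕ.≤-antisym
  (count-mono P? Q? (Equivalence.to P⇔Q) xs)
  (count-mono Q? P? (Equivalence.from P⇔Q) xs)

count-mono-< : {P Q : A → Set} (P? : Decidable P) (Q? : Decidable Q) → (∀ {x} → P x → Q x) →
               ∀ {x xs} → x ∈ xs → ¬ P x → Q x → count P? xs < count Q? xs
count-mono-< P? Q? P⊆Q {x} (here {xs = xs} refl) ¬p q with P? x | Q? x
... | yes p | _     = contradiction p ¬p
... | no _  | yes _ = s≤s (count-mono P? Q? P⊆Q xs)
... | no _  | no ¬q = contradiction q ¬q
count-mono-< P? Q? P⊆Q (there {x = y} x∈) ¬p q with P? y | Q? y
... | yes _ | yes _ = s≤s (count-mono-< P? Q? P⊆Q x∈ ¬p q)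
... | yes p | no ¬q = contradiction (P⊆Q p) ¬q
... | no _  | yes _ = ℕ.m≤n⇒m≤1+n (count-mono-< P? Q? P⊆Q x∈ ¬p q)
... | no _  | no _  = count-mono-< P? Q? P⊆Q x∈ ¬p q

count-⊎ : {P Q R : A → Set} (P? : Decidable P) (Q? : Decidable Q) (R? : Decidable R) →
          (∀ {x} → R x ⇔ (P x ⊎ Q x)) → (∀ {x} → P x → ¬ Q x) →
          ∀ xs → count R? xs ≡ count P? xs + count Q? xs
count-⊎ P? Q? R? R⇔P⊎Q disjoint []       = refl
count-⊎ P? Q? R? R⇔P⊎Q disjoint (x ∷ xs)
  with ih ← count-⊎ P? Q? R? R⇔P⊎Q disjoint xs | P? x | Q? x | R? x
... | yes p | yes q | _     = contradiction q (disjoint p)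
... | yes _ | no _  | yes _ = cong suc ih
... | yes p | no _  | no ¬r = contradiction (Equivalence.from R⇔P⊎Q (inj₁ p)) ¬r
... | no _  | yes _ | yes _ = trans (cong suc ih) (sym (ℕ.+-suc _ _))
... | no _  | yes q | no ¬r = contradiction (Equivalence.from R⇔P⊎Q (inj₂ q)) ¬r
... | no ¬p | no ¬q | yes r = contradiction (Equivalence.to R⇔P⊎Q r) [ ¬p , ¬q ]′
... | no _  | no _  | no _  = ih

count-≤1 : {P : A → Set} (P? : Decidable P) → (∀ {x y} → P x → P y → x ≡ y) →
           ∀ {xs} → Unique xs → count P? xs ≤ 1
count-≤1 {P = P} P? P-unique {xs} xs! =
  go (Unique.filter⁺ P? xs!) (λ x∈ → proj₂ (∈.∈-filter⁻ P? {xs = xs} x∈))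
  where
  go : ∀ {ys} → Unique ys → (∀ {y} → y ∈ ys → P y) → length ys ≤ 1
  go {[]}        _               _   = z≤n
  go {_ ∷ []}    _               _   = s≤s z≤n
  go {_ ∷ _ ∷ _} ((y≢z ∷ _) ∷ _) sat =
    contradiction (P-unique (sat (here refl)) (sat (there (here refl)))) y≢z

count-map : {P : B → Set} (f : A → B) (P? : Decidable P) →
            ∀ xs → count P? (List.map f xs) ≡ count (P? ∘ f) xs
count-map f P? []       = refl
count-map f P? (x ∷ xs) with P? (f x)
... | yes _ = cong suc (count-map f P? xs)
... | no _  = count-map f P? xs

count-++ : {P : A → Set} (P? : Decidable P) →
           ∀ xs ys → count P? (xs ++ ys) ≡ count P? xs + count P? ys
count-++ P? xs ys = trans (cong length (List.filter-++ P? xs ys)) (List.length-++ (filter P? xs))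

count-witness : {P : A → Set} (P? : Decidable P) → ∀ xs → count P? xs ≢ 0 → ∃[ x ] P x
count-witness P? []       ≢0 = contradiction refl ≢0
count-witness P? (x ∷ xs) ≢0 with P? x
... | yes p = x , p
... | no _  = count-witness P? xs ≢0

-- Links the `Vec.count` in `occurrences` to counting over lists of cells.
count-tabulate : ∀ {n} {P : ℕ → Set} (f : Fin n → ℕ) (P? : Decidable P) →
                 count (P? ∘ f) (allFin n) ≡ Vec.count P? (tabulate f)
count-tabulate {n = zero}  f P? = refl
count-tabulate {n = suc n} f P? with P? (f zero) | tail
  where
  tail : count (P? ∘ f) (List.tabulate suc) ≡ Vec.count P? (tabulate (f ∘ suc))
  tail = begin
    count (P? ∘ f) (List.tabulate suc)         ≡⟨ cong (count (P? ∘ f)) (List.map-tabulate id suc) ⟨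
    count (P? ∘ f) (List.map suc (allFin n))   ≡⟨ count-map suc (P? ∘ f) (allFin n) ⟩
    count (P? ∘ f ∘ suc) (allFin n)            ≡⟨ count-tabulate (f ∘ suc) P? ⟩
    Vec.count P? (tabulate (f ∘ suc))          ∎
    where open ≡-Reasoning
... | yes _ | eq = cong suc eq
... | no _  | eq = eq

-- Junk value m if no k < m satisfies P.
least : {P : ℕ → Set} → Decidable P → ℕ → ℕ
least P? zero    = 0
least P? (suc m) with P? 0
... | yes _ = 0
... | no _  = suc (least (P? ∘ suc) m)

least-satisfies : {P : ℕ → Set} (P? : Decidable P) → ∀ {k m} → P k → k ≤ m → P (least P? m)
least-satisfies P? {m = zero}  p z≤n = p
least-satisfies P? {m = suc m} p k≤m with P? 0
... | yes p₀ = p₀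
least-satisfies P? {zero}  {suc m} p k≤m       | no ¬p₀ = contradiction p ¬p₀
least-satisfies P? {suc k} {suc m} p (s≤s k≤m) | no ¬p₀ = least-satisfies (P? ∘ suc) p k≤m

least-≤ : {P : ℕ → Set} (P? : Decidable P) → ∀ {k} m → P k → least P? m ≤ k
least-≤ P? zero    p = z≤n
least-≤ P? (suc m) p with P? 0
... | yes _ = z≤n
least-≤ P? {zero}  (suc m) p | no ¬p₀ = contradiction p ¬p₀
least-≤ P? {suc k} (suc m) p | no _   = s≤s (least-≤ (P? ∘ suc) m p)

-- Partial sums and fixed slides

psum : ∀ {n} → WeakComposition n → ℕ → ℕ
psum _       zero    = 0
psum []      (suc p) = 0
psum (x ∷ c) (suc p) = x + psum c p

psum-mono : ∀ {n} (c : WeakComposition n) {p q} → p ≤ q → psum c p ≤ psum c q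
psum-mono []      {zero}  _         = z≤n
psum-mono []      {suc p} (s≤s _)   = z≤n
psum-mono (x ∷ c) z≤n       = z≤n
psum-mono (x ∷ c) (s≤s p≤q) = ℕ.+-monoʳ-≤ x (psum-mono c p≤q)

psum-injective : ∀ {n} (c d : WeakComposition n) → (∀ {p} → p ≤ n → psum c p ≡ psum d p) → c ≡ d
psum-injective []      []      _  = refl
psum-injective (x ∷ c) (y ∷ d) eq
  with refl ← trans (sym (ℕ.+-identityʳ x)) (trans (eq (s≤s z≤n)) (ℕ.+-identityʳ y)) =
  cong (x ∷_) (psum-injective c d λ p≤n → ℕ.+-cancelˡ-≡ x _ _ (eq (s≤s p≤n)))

-- Telescoping: `g` is the difference sequence of `F`.
psum-tabulate : ∀ n (g F : ℕ → ℕ) → (∀ p → F (suc p) ≡ F p + g p) →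
                ∀ {p} → p ≤ n → F 0 + psum (tabulate {n = n} (g ∘ toℕ)) p ≡ F p
psum-tabulate n       g F step z≤n       = ℕ.+-identityʳ _
psum-tabulate (suc n) g F step {suc p} (s≤s p≤n) = begin
  F 0 + (g 0 + psum (tabulate (g ∘ suc ∘ toℕ)) p) ≡⟨ ℕ.+-assoc (F 0) (g 0) _ ⟨
  F 0 + g 0 + psum (tabulate (g ∘ suc ∘ toℕ)) p   ≡⟨ cong (_+ psum (tabulate (g ∘ suc ∘ toℕ)) p) (step 0) ⟨
  F 1 + psum (tabulate (g ∘ suc ∘ toℕ)) p         ≡⟨ psum-tabulate n (g ∘ suc) (F ∘ suc) (step ∘ suc) p≤n ⟩
  F (suc p)                                       ∎
  where open ≡-Reasoning

-- Fixed slides described without moves: each nonzero part of `b` spreads over its own position and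
-- the run of zeros directly before it, leaving something in place. When `b` has trailing zeros,
-- `total` keeps them zero in `c`.
record IsSlide {n} (b c : WeakComposition n) : Set where
  field
    total : psum c n ≡ psum b n
    fixed : ∀ i → lookup b i ≢ 0 → lookup c i ≢ 0
    cut   : ∀ i → lookup b i ≢ 0 → psum c (suc (toℕ i)) ≡ psum b (suc (toℕ i))

-- A move changes only the partial sum ending at its left position. There `u` is zero, hence so is
-- `b`, so no `cut` condition refers to that sum.
move-slide : ∀ {n} {b u v : WeakComposition n} → Move b u v →
             (∀ i → lookup b i ≢ 0 → lookup u i ≢ 0) →
             psum v n ≡ psum u n ×
             (∀ i → lookup b i ≢ 0 → lookup v i ≢ 0 × psum v (suc (toℕ i)) ≡ psum u (suc (toℕ i)))
move-slide (here {u = u} {i = i} {j} refl pos) fixed =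
  sym (ℕ.+-assoc i j _) , λ
    { zero          b≢0 → contradiction refl (fixed zero b≢0)
    ; (suc zero)    b≢0 → ℕ.m<n⇒n≢0 (pos b≢0) , sym (ℕ.+-assoc i j 0)
    ; (suc (suc k)) b≢0 → fixed (suc (suc k)) b≢0 , sym (ℕ.+-assoc i j _)
    }
move-slide (there {x = x} m) fixed with total , cut ← move-slide m (fixed ∘ suc) =
  cong (x +_) total , λ
    { zero    b≢0 → fixed zero b≢0 , refl
    ; (suc i) b≢0 → proj₁ (cut i b≢0) , cong (x +_) (proj₂ (cut i b≢0))
    }

fixedSlide⇒slide : ∀ {n} {b c : WeakComposition n} → IsFixedSlide b c → IsSlide b c
fixedSlide⇒slide {b = b} = go (record { total = refl ; fixed = λ _ → id ; cut = λ _ _ → refl })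
  where
  go : ∀ {u c} → IsSlide b u → Star (Move b) u c → IsSlide b c
  go s ε       = s
  go s (m ◅ r) with total , cut ← move-slide m (IsSlide.fixed s) = go record
    { total = trans total (IsSlide.total s)
    ; fixed = λ i b≢0 → proj₁ (cut i b≢0)
    ; cut   = λ i b≢0 → trans (proj₂ (cut i b≢0)) (IsSlide.cut s i b≢0)
    } r

-- Induction from the left. If `b` starts with zero, the first two parts of `c` are pooled at the
-- second position, the tail is slid first, and a last move splits the pool. A positive first part
-- is pinned by `cut`.
slide⇒fixedSlide : ∀ {n} (b c : WeakComposition n) → IsSlide b c → IsFixedSlide b c
slide⇒fixedSlide []       []       s = ε
slide⇒fixedSlide (x ∷ []) (y ∷ []) s
  with refl ← ℕ.+-cancelʳ-≡ 0 y x (IsSlide.total s) = ε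
slide⇒fixedSlide (zero ∷ b₂ ∷ b) (i ∷ j ∷ c) s =
  gmap (0 ∷_) there (slide⇒fixedSlide (b₂ ∷ b) (i + j ∷ c) record
    { total = trans (ℕ.+-assoc i j _) total
    ; fixed = λ { zero b≢0 → fixed (suc zero) b≢0 ∘ ℕ.m+n≡0⇒n≡0 i ; (suc k) → fixed (suc (suc k)) }
    ; cut   = λ { zero b≢0 → trans (ℕ.+-assoc i j _) (cut (suc zero) b≢0)
                ; (suc k) b≢0 → trans (ℕ.+-assoc i j _) (cut (suc (suc k)) b≢0) }
    }) ◅◅ (here refl (ℕ.n≢0⇒n>0 ∘ fixed (suc zero)) ◅ ε)
  where open IsSlide s
slide⇒fixedSlide (suc x ∷ b₂ ∷ b) (y ∷ c₂ ∷ c) s =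
  subst (λ z → IsFixedSlide (suc x ∷ b₂ ∷ b) (z ∷ c₂ ∷ c)) x≡y
    (gmap (suc x ∷_) there (slide⇒fixedSlide (b₂ ∷ b) (c₂ ∷ c) record
      { total = cancel total
      ; fixed = fixed ∘ suc
      ; cut   = λ i b≢0 → cancel (cut (suc i) b≢0)
      }))
  where
  open IsSlide s
  x≡y : suc x ≡ y
  x≡y = ℕ.+-cancelʳ-≡ 0 (suc x) y (sym (cut zero λ ()))
  cancel : ∀ {p q} → y + p ≡ suc x + q → p ≡ q
  cancel {p} {q} eq = ℕ.+-cancelˡ-≡ y p q (trans eq (cong (_+ q) x≡y))

-- Sums of monomials

-- Different fillings may share a weight. Labels in `A` keep their terms apart, so that
-- duplicate-free lists can be compared as sets.
monomials : ∀ {n} → List (A × WeakComposition n) → Polynomial n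
monomials = List.map λ (_ , c) → 1ℤ , c

termCoeff : ∀ {n} → ℤ → (c e : WeakComposition n) → ℤ
termCoeff k c e = if does (c ≟ᵥ e) then k else 0ℤ

coeff-↭ : ∀ {n} {p q : Polynomial n} → p ↭ q → p ≈ q
coeff-↭ ↭.refl                       e = refl
coeff-↭ (↭.prep (k , c) p↭q)         e = cong (ℤ._+_ (termCoeff k c e)) (coeff-↭ p↭q e)
coeff-↭ (↭.swap (k , c) (l , d) p↭q) e = trans
  (cong (λ z → termCoeff k c e ℤ.+ (termCoeff l d e ℤ.+ z)) (coeff-↭ p↭q e))
  (x∙yz≈y∙xz (termCoeff k c e) (termCoeff l d e) _)
coeff-↭ (↭.trans p↭q q↭r)            e = trans (coeff-↭ p↭q e) (coeff-↭ q↭r e)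

pairs : List A → (A → List B) → List (A × B)
pairs xs f = concatMap (λ x → List.map (x ,_) (f x)) xs

∈-pairs⁺ : ∀ {xs} (f : A → List B) {x y} → x ∈ xs → y ∈ f x → (x , y) ∈ pairs xs f
∈-pairs⁺ f x∈ y∈ = ∈.∈-concatMap⁺ _ (lose x∈ (∈.∈-map⁺ (_ ,_) y∈))

∈-pairs⁻ : ∀ {xs} (f : A → List B) {x y} → (x , y) ∈ pairs xs f → x ∈ xs × y ∈ f x
∈-pairs⁻ f xy∈ with _ , x∈ , y∈′ ← find (∈.∈-concatMap⁻ (λ x → List.map (x ,_) (f x)) xy∈)
  with _ , y∈ , refl ← ∈.∈-map⁻ (_ ,_) y∈′ = x∈ , y∈

pairs-unique : ∀ {xs} (f : A → List B) → Unique xs → (∀ x → Unique (f x)) → Unique (pairs xs f)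
pairs-unique {xs = []}     f []          f! = []
pairs-unique {xs = x ∷ xs} f (x∉xs ∷ xs!) f! =
  Unique.++⁺ (Unique.map⁺ (cong proj₂) (f! x)) (pairs-unique f xs! f!) disjoint
  where
  disjoint : ∀ {z} → ¬ (z ∈ List.map (x ,_) (f x) × z ∈ pairs xs f)
  disjoint (z∈ , z∈′) with _ , _ , refl ← ∈.∈-map⁻ (x ,_) z∈ =
    ListAll.lookup x∉xs (proj₁ (∈-pairs⁻ f z∈′)) refl

map-unique : ∀ {xs : List A} (f : A → B) → (∀ {x y} → x ∈ xs → y ∈ xs → f x ≡ f y → x ≡ y) →
             Unique xs → Unique (List.map f xs)
map-unique f f-injective []           = []
map-unique f f-injective (x∉xs ∷ xs!) =
  ListAll.map⁺ (ListAll.tabulate λ y∈ fx≡fy →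
    ListAll.lookup x∉xs y∈ (f-injective (here refl) (there y∈) fx≡fy))
  ∷ map-unique f (λ x∈ y∈ → f-injective (there x∈) (there y∈)) xs!

unique∧set⇒↭ : {xs ys : List A} → Unique xs → Unique ys → (∀ {x} → x ∈ xs ⇔ x ∈ ys) → xs ↭ ys
unique∧set⇒↭ xs! ys! eq = ∼bag⇒↭ (unique∧set⇒bag xs! ys! eq)

∑-monomials : ∀ {P : A → Set} {n} (X : FiniteSet P) (f : A → WeakComposition n) (g : A → B) →
  (∑[ x ∈ X ] x^ f x) ≡ monomials (List.map (λ x → g x , f x) (elements X))
∑-monomials X f g = trans (sym (List.concatMap-map List.[_] (λ x → 1ℤ , f x) (elements X)))
  (trans (List.concatMap-pure _) (List.map-∘ (elements X)))

∑∑-monomials : ∀ {P : A → Set} {n} {Q : A → WeakComposition n → Set}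
  (X : FiniteSet P) (Y : ∀ x → FiniteSet (Q x)) →
  (∑[ x ∈ X ] ∑[ c ∈ Y x ] x^ c) ≡ monomials (pairs (elements X) (λ x → elements (Y x)))
∑∑-monomials X Y = trans
  (List.concatMap-cong (λ x → ∑-monomials (Y x) id (λ _ → x)) (elements X))
  (sym (List.map-concatMap _ _ (elements X)))

-- An injection of a finite set into as many numbers is a bijection. Raising the bound by one admits
-- at most one more element: starting from none this gives `upper`, and ending with all of them it
-- gives `lower`.
count-rank : (f : A → ℕ) → (∀ {x y} → f x ≡ f y → x ≡ y) → ∀ {xs} → Unique xs →
             (∀ x → f x < length xs) → ∀ {m} → m ≤ length xs → count (λ x → f x <? m) xs ≡ m
count-rank f f-injective {xs} xs! f< {m} m≤ = ℕ.≤-antisym upper lower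
  where
  below : ℕ → ℕ
  below k = count (λ x → f x <? k) xs

  split-last : ∀ {k x} → f x < suc k ⇔ (f x < k ⊎ f x ≡ k)
  split-last = mk⇔ (ℕ.m≤n⇒m<n∨m≡n ∘ ℕ.≤-pred) [ ℕ.m≤n⇒m≤1+n , (λ { refl → ℕ.≤-refl }) ]′

  step : ∀ k → below (suc k) ≤ suc (below k)
  step k = begin
    below (suc k)
      ≡⟨ count-⊎ (λ x → f x <? k) (λ x → f x ≟ k) (λ x → f x <? suc k) split-last ℕ.<⇒≢ xs ⟩
    below k + count (λ x → f x ≟ k) xs
      ≤⟨ ℕ.+-monoʳ-≤ (below k)
           (count-≤1 (λ x → f x ≟ k) (λ p q → f-injective (trans p (sym q))) xs!) ⟩
    below k + 1
      ≡⟨ ℕ.+-comm (below k) 1 ⟩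
    suc (below k) ∎
    where open ℕ.≤-Reasoning

  steps : ∀ d k → below (d + k) ≤ d + below k
  steps zero    k = ℕ.≤-refl
  steps (suc d) k = ℕ.≤-trans (step (d + k)) (s≤s (steps d k))

  upper : below m ≤ m
  upper = begin
    below m       ≡⟨ cong below (ℕ.+-identityʳ m) ⟨
    below (m + 0) ≤⟨ steps m 0 ⟩
    m + below 0   ≡⟨ cong (λ ys → m + length ys)
                       (List.filter-none (λ x → f x <? 0) (ListAll.universal (λ _ ()) xs)) ⟩
    m + 0         ≡⟨ ℕ.+-identityʳ m ⟩
    m             ∎
    where open ℕ.≤-Reasoning

  lower : m ≤ below m
  lower = ℕ.+-cancelˡ-≤ (length xs ∸ m) m (below m) (begin
    length xs ∸ m + m
      ≡⟨ ℕ.m∸n+n≡m m≤ ⟩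
    length xs
      ≡⟨ cong length (List.filter-all (λ x → f x <? length xs) (ListAll.universal f< xs)) ⟨
    below (length xs)
      ≡⟨ cong below (ℕ.m∸n+n≡m m≤) ⟨
    below (length xs ∸ m + m)
      ≤⟨ steps (length xs ∸ m) m ⟩
    length xs ∸ m + below m ∎)
    where open ℕ.≤-Reasoning

-- Fillings as functions on cells

raise : ∀ {n m} {a : WeakComposition n} → Cell a → Cell (m ∷ a)
raise (cell i c) = cell (suc i) c

cells : ∀ {n} (a : WeakComposition n) → List (Cell a)
cells []      = []
cells (m ∷ a) = List.map (cell zero) (allFin m) ++ List.map raise (cells a)

∈-cells : ∀ {n} {a : WeakComposition n} (x : Cell a) → x ∈ cells a
∈-cells {a = m ∷ a} (cell zero c)    = ∈.∈-++⁺ˡ (∈.∈-map⁺ (cell zero) (∈.∈-allFin c))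
∈-cells {a = m ∷ a} (cell (suc i) c) =
  ∈.∈-++⁺ʳ (List.map (cell zero) (allFin m)) (∈.∈-map⁺ raise (∈-cells (cell i c)))

cells-unique : ∀ {n} (a : WeakComposition n) → Unique (cells a)
cells-unique []      = []
cells-unique (m ∷ a) = Unique.++⁺
  (Unique.map⁺ (λ { refl → refl }) (Unique.allFin⁺ m))
  (Unique.map⁺ (λ { {cell _ _} {cell _ _} refl → refl }) (cells-unique a))
  λ (x∈ , x∈′) → disjoint (∈.∈-map⁻ (cell zero) x∈) (∈.∈-map⁻ raise x∈′)
  where
  disjoint : ∀ {x} → ∃[ c ] c ∈ allFin m × x ≡ cell zero c → ¬ (∃[ y ] y ∈ cells a × x ≡ raise y)
  disjoint (_ , _ , refl) (cell _ _ , _ , ())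

build : ∀ {n} {a : WeakComposition n} → (Cell a → ℕ) → Filling a
build {a = []}    f = []
build {a = m ∷ a} f = tabulate (f ∘ cell zero) ∷ build (f ∘ raise)

entry-build : ∀ {n} {a : WeakComposition n} (f : Cell a → ℕ) x → entry (build f) x ≡ f x
entry-build {a = m ∷ a} f (cell zero c)    = Vec.lookup∘tabulate (f ∘ cell zero) c
entry-build {a = m ∷ a} f (cell (suc i) c) = entry-build (f ∘ raise) (cell i c)

entry-injective : ∀ {n} {a : WeakComposition n} (S T : Filling a) →
                  (∀ x → entry S x ≡ entry T x) → S ≡ T
entry-injective []      []      eq = refl
entry-injective (r ∷ S) (t ∷ T) eq = cong₂ _∷_
  (trans (sym (Vec.tabulate∘lookup r))
    (trans (Vec.tabulate-cong (eq ∘ cell zero)) (Vec.tabulate∘lookup t)))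
  (entry-injective S T (λ { (cell i c) → eq (cell (suc i) c) }))

occurrences-count : ∀ {n} {a : WeakComposition n} v (S : Filling a) →
                    occurrences v S ≡ count (λ x → entry S x ≟ v) (cells a)
occurrences-count         v []      = refl
occurrences-count {a = m ∷ a} v (r ∷ S) = sym (begin
  count P? (List.map (cell zero) (allFin m) ++ List.map raise (cells a))
    ≡⟨ count-++ P? (List.map (cell zero) (allFin m)) _ ⟩
  count P? (List.map (cell zero) (allFin m)) + count P? (List.map raise (cells a))
    ≡⟨ cong₂ _+_ (count-map (cell zero) P? (allFin m)) (count-map raise P? (cells a)) ⟩
  count (λ c → lookup r c ≟ v) (allFin m) + count (P? ∘ raise) (cells a)
    ≡⟨ cong₂ _+_ (trans (count-tabulate (lookup r) (_≟ v))
                        (cong (Vec.count (_≟ v)) (Vec.tabulate∘lookup r)))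
                 (sym (occurrences-count v S)) ⟩
  Vec.count (_≟ v) r + occurrences v S ∎)
  where
  open ≡-Reasoning
  P? : Decidable (λ x → entry (r ∷ S) x ≡ v)
  P? x = entry (r ∷ S) x ≟ v

-- Weights, reading orders and coarsenings

module _ {n : ℕ} {a : WeakComposition n} where

  cells≤ : Filling a → ℕ → ℕ
  cells≤ S p = count (λ x → entry S x ≤? p) (cells a)

  cells≤-all : ∀ (S : Filling a) {p} → (∀ x → entry S x ≤ p) → cells≤ S p ≡ length (cells a)
  cells≤-all S {p} S≤p =
    cong length (List.filter-all (λ x → entry S x ≤? p) (ListAll.universal S≤p (cells a)))

  -- The occurrences of `suc k` are the increments of `cells≤ S`, and positivity makes the count
  -- start at zero.
  psum-wt : ∀ (S : Filling a) → (∀ x → entry S x > 0) → ∀ {p} → p ≤ n → psum (wt S) p ≡ cells≤ S p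
  psum-wt S positive {p} p≤n = begin
    psum (wt S) p
      ≡⟨ cong (_+ psum (wt S) p) cells≤0 ⟨
    cells≤ S 0 + psum (wt S) p
      ≡⟨ psum-tabulate n (λ k → occurrences (suc k) S) (cells≤ S) step p≤n ⟩
    cells≤ S p ∎
    where
    open ≡-Reasoning
    cells≤0 : cells≤ S 0 ≡ 0
    cells≤0 = cong length (List.filter-none (λ x → entry S x ≤? 0)
                (ListAll.universal (λ x → ℕ.<⇒≱ (positive x)) (cells a)))

    step : ∀ k → cells≤ S (suc k) ≡ cells≤ S k + occurrences (suc k) S
    step k = trans
      (count-⊎ (λ x → entry S x ≤? k) (λ x → entry S x ≟ suc k) (λ x → entry S x ≤? suc k)
        (mk⇔ (λ le → Sum.map₁ ℕ.≤-pred (ℕ.m≤n⇒m<n∨m≡n le)) [ ℕ.m≤n⇒m≤1+n , ℕ.≤-reflexive ]′)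
        (λ le eq → ℕ.1+n≰n (subst (_≤ k) eq le)) (cells a))
      (cong (cells≤ S k +_) (sym (occurrences-count (suc k) S)))

  wt≢0⇔appears : ∀ (S : Filling a) i → lookup (wt S) i ≢ 0 ⇔ Appears S (suc (toℕ i))
  wt≢0⇔appears S i = mk⇔
    (λ ≢0 → count-witness P? (cells a) (≢0 ∘ trans eq))
    (λ (x , Sx≡) → ℕ.m<n⇒n≢0 (List.filter-some P? (lose (∈-cells x) Sx≡)) ∘ trans (sym eq))
    where
    P? : Decidable (λ x → entry S x ≡ suc (toℕ i))
    P? x = entry S x ≟ suc (toℕ i)
    eq : lookup (wt S) i ≡ count P? (cells a)
    eq = trans (Vec.lookup∘tabulate (λ j → occurrences (suc (toℕ j)) S) i) (occurrences-count _ S)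

  -- For `col x ≤ col y`, the strict inequality says exactly that `x` is read before `y`, because
  -- among equal entries the one further right is read first.
  SameOrder : (S T : Filling a) → Set
  SameOrder S T = ∀ x y → col x ≤ col y → entry S x < entry S y ⇔ entry T x < entry T y

  sameOrder-sym : ∀ {S T} → SameOrder S T → SameOrder T S
  sameOrder-sym S~T x y x≤y = ⇔-sym (S~T x y x≤y)

  sameOrder-trans : ∀ {S T U} → SameOrder S T → SameOrder T U → SameOrder S U
  sameOrder-trans S~T T~U x y x≤y = T~U x y x≤y ⇔-∘ S~T x y x≤y

  ASSF-transfer : ∀ {S T} → SameOrder S T → IsASSF a S → (∀ x → entry T x > 0) →
                  (∀ x → col x ≡ 0 → entry T x ≡ suc (toℕ (row x))) → IsASSF a T
  ASSF-transfer {S} {T} S~T p pos first = record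
    { positive        = pos
    ; rows-decreasing = λ x y rows cols → ≥-transfer x y cols (rows-decreasing x y rows cols)
    ; column-distinct = distinct
    ; triples         = inversions
    ; first-column    = first
    }
    where
    open IsASSF p
    <-transfer : ∀ x y → col x ≤ col y → entry S x < entry S y → entry T x < entry T y
    <-transfer x y x≤y = Equivalence.to (S~T x y x≤y)

    ≥-transfer : ∀ x y → col x ≤ col y → entry S x ≥ entry S y → entry T x ≥ entry T y
    ≥-transfer x y x≤y Sx≥Sy = ℕ.≮⇒≥ λ Tx<Ty →
      ℕ.≤⇒≯ Sx≥Sy (Equivalence.from (S~T x y x≤y) Tx<Ty)

    distinct : ∀ x y → col x ≡ col y → x ≢ y → entry T x ≢ entry T y
    distinct x y cols x≢y Tx≡Ty with ℕ.<-cmp (entry S x) (entry S y)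
    ... | tri< Sx<Sy _ _ = ℕ.<⇒≢ (<-transfer x y (ℕ.≤-reflexive cols) Sx<Sy) Tx≡Ty
    ... | tri≈ _ Sx≡Sy _ = column-distinct x y cols x≢y Sx≡Sy
    ... | tri> _ _ Sy<Sx = ℕ.<⇒≢ (<-transfer y x (ℕ.≤-reflexive (sym cols)) Sy<Sx) (sym Tx≡Ty)

    -- Both types of triple place `β` weakly between the columns of `γ` and `α`, so each of the
    -- three comparisons is between a cell and one weakly to its right.
    transfer : ∀ γ α β → col γ ≤ col α → col γ ≤ col β → col β ≤ col α →
               Inversion (entry S γ) (entry S α) (entry S β) →
               Inversion (entry T γ) (entry T α) (entry T β)
    transfer γ α β γα γβ βα (inj₁ (β>γ , γ≥α)) =
      inj₁ (<-transfer γ β γβ β>γ , ≥-transfer γ α γα γ≥α)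
    transfer γ α β γα γβ βα (inj₂ (γ≥α , α>β)) =
      inj₂ (≥-transfer γ α γα γ≥α , <-transfer β α βα α>β)

    inversions : ∀ γ α β → TypeA a γ α β ⊎ TypeB a γ α β →
                 Inversion (entry T γ) (entry T α) (entry T β)
    inversions γ α β t@(inj₁ ((_ , α≡1+γ) , _ , β≡α , _)) =
      transfer γ α β γ≤α (ℕ.≤-trans γ≤α (ℕ.≤-reflexive (sym β≡α))) (ℕ.≤-reflexive β≡α)
        (triples γ α β t)
      where
      γ≤α : col γ ≤ col α
      γ≤α = ℕ.≤-trans (ℕ.n≤1+n _) (ℕ.≤-reflexive (sym α≡1+γ))
    inversions γ α β t@(inj₂ ((_ , α≡1+γ) , _ , β≡γ , _)) =
      transfer γ α β γ≤α (ℕ.≤-reflexive (sym β≡γ)) (ℕ.≤-trans (ℕ.≤-reflexive β≡γ) γ≤α)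
        (triples γ α β t)
      where
      γ≤α : col γ ≤ col α
      γ≤α = ℕ.≤-trans (ℕ.n≤1+n _) (ℕ.≤-reflexive (sym α≡1+γ))

  -- {y : T′ y ≤ T x} and {y : T y ≤ T x} are initial segments of the same order, of the
  -- same size by equality of weights, so T x < T′ x would separate them.
  sameOrder∧wt⇒≥ : ∀ {T T′} → IsASSF a T → IsASSF a T′ → SameOrder T T′ → wt T ≡ wt T′ →
                   ∀ x → entry T x ≥ entry T′ x
  sameOrder∧wt⇒≥ {T} {T′} p p′ T~T′ wt≡ x = ℕ.≮⇒≥ λ Tx<T′x →
    ℕ.<-irrefl (sym cells≡) (count-mono-< (λ y → entry T′ y ≤? v) (λ y → entry T y ≤? v)
      (λ {y} T′y≤v → ℕ.≮⇒≥ (below Tx<T′x y T′y≤v)) (∈-cells x) (ℕ.<⇒≱ Tx<T′x) ℕ.≤-refl)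
    where
    v : ℕ
    v = entry T x

    cells≡ : cells≤ T v ≡ cells≤ T′ v
    cells≡ = begin
      cells≤ T v     ≡⟨ psum-wt T (IsASSF.positive p) v≤n ⟨
      psum (wt T) v  ≡⟨ cong (λ c → psum c v) wt≡ ⟩
      psum (wt T′) v ≡⟨ psum-wt T′ (IsASSF.positive p′) v≤n ⟩
      cells≤ T′ v    ∎
      where
      open ≡-Reasoning
      v≤n = ASSF-bounded p x

    -- The two fillings would order `x` and `y` oppositely; `SameOrder` is applied with the cell
    -- further left first.
    below : v < entry T′ x → ∀ y → entry T′ y ≤ v → ¬ (v < entry T y)
    below Tx<T′x y T′y≤v Tx<Ty with ℕ.≤-total (col y) (col x)
    ... | inj₁ y≤x = ℕ.<-asym Tx<Ty (Equivalence.from (T~T′ y x y≤x) (ℕ.≤-<-trans T′y≤v Tx<T′x))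
    ... | inj₂ x≤y = ℕ.<-asym (ℕ.≤-<-trans T′y≤v Tx<T′x) (Equivalence.to (T~T′ x y x≤y) Tx<Ty)

  sameOrder∧wt⇒≡ : ∀ {T T′} → IsASSF a T → IsASSF a T′ → SameOrder T T′ → wt T ≡ wt T′ → T ≡ T′
  sameOrder∧wt⇒≡ {T} {T′} p p′ T~T′ wt≡ = entry-injective T T′ λ x → ℕ.≤-antisym
    (sameOrder∧wt⇒≥ p′ p (sameOrder-sym {T} {T′} T~T′) (sym wt≡) x)
    (sameOrder∧wt⇒≥ p p′ T~T′ wt≡ x)

  -- By below and cut, entry S x is the least value of S that is ≥ entry T x.
  record Coarsening (T S : Filling a) : Set where
    field
      sameOrder : SameOrder S T
      below     : ∀ x → entry T x ≤ entry S x
      cut       : ∀ x y → entry T x ≤ entry S y → entry S x ≤ entry S y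
      kept      : ∀ x → Appears T (entry S x)

  -- If `v` is a value of `S`, then `below` and `cut` make `entry T x ≤ v` equivalent to
  -- `entry S x ≤ v`, so the partial sums of the weights agree at `v`. By `kept`, `v` also occurs in
  -- `T`.
  coarsening⇒slide : ∀ {T S} → IsASSF a T → IsASSF a S → Coarsening T S → IsSlide (wt S) (wt T)
  coarsening⇒slide {T} {S} p q T→S = record
    { total = begin
        psum (wt T) n    ≡⟨ psum-wt T (IsASSF.positive p) ℕ.≤-refl ⟩
        cells≤ T n       ≡⟨ cells≤-all T (ASSF-bounded p) ⟩
        length (cells a) ≡⟨ cells≤-all S (ASSF-bounded q) ⟨
        cells≤ S n       ≡⟨ psum-wt S (IsASSF.positive q) ℕ.≤-refl ⟨
        psum (wt S) n    ∎
    ; fixed = λ i S≢0 → let y , Sy≡ = Equivalence.to (wt≢0⇔appears S i) S≢0 in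
        Equivalence.from (wt≢0⇔appears T i) (subst (Appears T) Sy≡ (kept y))
    ; cut   = λ i S≢0 → let y , Sy≡ = Equivalence.to (wt≢0⇔appears S i) S≢0 in begin
        psum (wt T) (suc (toℕ i)) ≡⟨ psum-wt T (IsASSF.positive p) (Fin.toℕ<n i) ⟩
        cells≤ T (suc (toℕ i))    ≡⟨ count-cong _ _ (λ {x} → mk⇔
          (subst (λ v → entry T x ≤ v → entry S x ≤ v) Sy≡ (cut x y)) (ℕ.≤-trans (below x))) (cells a) ⟩
        cells≤ S (suc (toℕ i))    ≡⟨ psum-wt S (IsASSF.positive q) (Fin.toℕ<n i) ⟨
        psum (wt S) (suc (toℕ i)) ∎
    }
    where
    open ≡-Reasoning
    open Coarsening T→S

  -- Lifting a filling along a fixed slide of its weight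

  module Lift {S : Filling a} (p : IsASSF a S)
              {e : WeakComposition n} (slide : IsSlide (wt S) e) where
    open IsASSF p
    open IsSlide slide

    Before : Cell a → Cell a → Set
    Before u x = entry S u < entry S x ⊎ (entry S u ≡ entry S x × col x < col u)

    before? : ∀ u x → Dec (Before u x)
    before? u x = (entry S u <? entry S x) ⊎-dec ((entry S u ≟ entry S x) ×-dec (col x <? col u))

    before-irrefl : ∀ x → ¬ Before x x
    before-irrefl x = [ ℕ.<-irrefl refl , ℕ.<-irrefl refl ∘ proj₂ ]′

    before⇒≤ : ∀ {u x} → Before u x → entry S u ≤ entry S x
    before⇒≤ = [ ℕ.<⇒≤ , ℕ.≤-reflexive ∘ proj₁ ]′

    before-trans : ∀ {u x y} → Before u x → Before x y → Before u y
    before-trans (inj₁ u<x)         x≺y              = inj₁ (ℕ.<-≤-trans u<x (before⇒≤ x≺y))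
    before-trans (inj₂ (u≡x , _))   (inj₁ x<y)       = inj₁ (subst (_< _) (sym u≡x) x<y)
    before-trans (inj₂ (u≡x , x<u)) (inj₂ (x≡y , y<x)) = inj₂ (trans u≡x x≡y , ℕ.<-trans y<x x<u)

    before-total : ∀ {x y} → x ≢ y → Before x y ⊎ Before y x
    before-total {x} {y} x≢y with ℕ.<-cmp (entry S x) (entry S y) | ℕ.<-cmp (col x) (col y)
    ... | tri< lt _ _ | _            = inj₁ (inj₁ lt)
    ... | tri> _ _ gt | _            = inj₂ (inj₁ gt)
    ... | tri≈ _ eq _ | tri< lt _ _  = inj₂ (inj₂ (sym eq , lt))
    ... | tri≈ _ eq _ | tri> _ _ gt  = inj₁ (inj₂ (eq , gt))
    ... | tri≈ _ eq _ | tri≈ _ eqc _ = contradiction eq (column-distinct x y eqc x≢y)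

    rank : Cell a → ℕ
    rank x = count (λ u → before? u x) (cells a)

    rank-mono-≤ : ∀ {x y} → entry S x ≤ entry S y → col y ≤ col x → rank x ≤ rank y
    rank-mono-≤ {x} {y} Sx≤Sy y≤x = count-mono (λ u → before? u x) (λ u → before? u y) sub (cells a)
      where
      sub : ∀ {u} → Before u x → Before u y
      sub (inj₁ u<x) = inj₁ (ℕ.<-≤-trans u<x Sx≤Sy)
      sub (inj₂ (u≡x , x<u)) with ℕ.m≤n⇒m<n∨m≡n Sx≤Sy
      ... | inj₁ x<y = inj₁ (subst (_< _) (sym u≡x) x<y)
      ... | inj₂ x≡y = inj₂ (trans u≡x x≡y , ℕ.≤-<-trans y≤x x<u)

    rank-mono-< : ∀ {x y} → Before x y → rank x < rank y
    rank-mono-< {x} {y} x≺y = count-mono-< (λ u → before? u x) (λ u → before? u y)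
      (λ u≺x → before-trans u≺x x≺y) (∈-cells x) (before-irrefl x) x≺y

    rank-injective : ∀ {x y} → rank x ≡ rank y → x ≡ y
    rank-injective {x} {y} eq with x ≟ᶜ y
    ... | yes x≡y = x≡y
    ... | no x≢y with before-total x≢y
    ...   | inj₁ x≺y = contradiction eq (ℕ.<⇒≢ (rank-mono-< x≺y))
    ...   | inj₂ y≺x = contradiction (sym eq) (ℕ.<⇒≢ (rank-mono-< y≺x))

    rank< : ∀ x → rank x < length (cells a)
    rank< x = List.filter-notAll (λ u → before? u x) (cells a) (lose (∈-cells x) (before-irrefl x))

    psum-n : psum e n ≡ length (cells a)
    psum-n = trans total (trans (psum-wt S positive ℕ.≤-refl) (cells≤-all S (ASSF-bounded p)))

    index : ∀ x → ∃[ i ] suc (toℕ {n} i) ≡ entry S x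
    index x with entry S x | positive x | ASSF-bounded p x
    ... | suc k | _ | k<n = fromℕ< k<n , cong suc (Fin.toℕ-fromℕ< k<n)

    -- The cell `x` makes the corresponding part of `wt S` nonzero, so `cut` applies: a run of `e`
    -- ends wherever a block of equal entries of `S` ends.
    psum-entry : ∀ x → psum e (entry S x) ≡ cells≤ S (entry S x)
    psum-entry x with i , eq ← index x = begin
      psum e (entry S x)      ≡⟨ cong (psum e) eq ⟨
      psum e (suc (toℕ i))    ≡⟨ cut i (Equivalence.from (wt≢0⇔appears S i) (x , sym eq)) ⟩
      psum (wt S) (suc (toℕ i)) ≡⟨ cong (psum (wt S)) eq ⟩
      psum (wt S) (entry S x) ≡⟨ psum-wt S positive (ASSF-bounded p x) ⟩
      cells≤ S (entry S x)    ∎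
      where open ≡-Reasoning

    -- Each cell gets the number of the run of `e` containing its zero-based position `rank x`. The
    -- search bound `n` itself satisfies the condition, since the runs together cover all cells.
    lift : Filling a
    lift = build λ x → least (λ v → rank x <? psum e v) n

    -- A Galois connection between entries and partial sums; it reduces statements about `lift` to
    -- statements about ranks.
    lift≤⇔ : ∀ x {v} → entry lift x ≤ v ⇔ rank x < psum e v
    lift≤⇔ x {v} rewrite entry-build (λ x → least (λ v → rank x <? psum e v) n) x = mk⇔
      (λ le → ℕ.<-≤-trans
        (least-satisfies (λ v → rank x <? psum e v) {n}
          (subst (rank x <_) (sym psum-n) (rank< x)) ℕ.≤-refl)
        (psum-mono e le))
      (least-≤ (λ v → rank x <? psum e v) n)

    lift-positive : ∀ x → entry lift x > 0
    lift-positive x = ℕ.≰⇒> λ le → ℕ.n≮0 (Equivalence.to (lift≤⇔ x) le)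

    -- The cells with entry at most `v` are those of rank below `psum e v`, and `count-rank` says
    -- how many these are.
    wt-lift : wt lift ≡ e
    wt-lift = psum-injective (wt lift) e λ {v} v≤n → begin
      psum (wt lift) v
        ≡⟨ psum-wt lift lift-positive v≤n ⟩
      cells≤ lift v
        ≡⟨ count-cong _ _ (λ {x} → lift≤⇔ x) (cells a) ⟩
      count (λ x → rank x <? psum e v) (cells a)
        ≡⟨ count-rank rank rank-injective (cells-unique a) rank<
             (subst (psum e v ≤_) psum-n (psum-mono e v≤n)) ⟩
      psum e v ∎
      where open ≡-Reasoning

    -- The cells with `S`-entry at most `entry S y` form an initial segment of the reading order, of
    -- size `psum e (entry S y)`.
    lift≤entry⇔ : ∀ x y → entry lift x ≤ entry S y ⇔ entry S x ≤ entry S y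
    lift≤entry⇔ x y =
      rank<⇔ ⇔-∘ subst (λ k → entry lift x ≤ entry S y ⇔ rank x < k) (psum-entry y) (lift≤⇔ x)
      where
      rank<⇔ : rank x < cells≤ S (entry S y) ⇔ entry S x ≤ entry S y
      rank<⇔ = mk⇔
        (λ rank< → ℕ.≮⇒≥ λ Sy<Sx → ℕ.<⇒≱ rank<
          (count-mono (λ u → entry S u ≤? entry S y) (λ u → before? u x)
            (λ Su≤Sy → inj₁ (ℕ.≤-<-trans Su≤Sy Sy<Sx)) (cells a)))
        (λ Sx≤Sy → count-mono-< (λ u → before? u x) (λ u → entry S u ≤? entry S y)
          (λ u≺x → ℕ.≤-trans (before⇒≤ u≺x) Sx≤Sy) (∈-cells x) (before-irrefl x) Sx≤Sy)

    lift-coarsening : Coarsening lift S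
    lift-coarsening = record
      { sameOrder = λ x y x≤y → mk⇔
          (λ Sx<Sy → ℕ.≤-<-trans (lift≤S x) (ℕ.≰⇒> (ℕ.<⇒≱ Sx<Sy ∘ Equivalence.to (lift≤entry⇔ y x))))
          -- If `entry S y ≤ entry S x` with `y` weakly right of `x`, then `y` is read no later than
          -- `x`, and `lift` is monotone in rank.
          (λ Tx<Ty → ℕ.≰⇒> λ Sy≤Sx → ℕ.<⇒≱ Tx<Ty (Equivalence.from (lift≤⇔ y)
            (ℕ.≤-<-trans (rank-mono-≤ Sy≤Sx x≤y) (Equivalence.to (lift≤⇔ x) ℕ.≤-refl))))
      ; below     = lift≤S
      ; cut       = λ x y → Equivalence.to (lift≤entry⇔ x y)
      ; kept      = λ x → let i , eq = index x in
          subst (Appears lift) eq (Equivalence.to (wt≢0⇔appears lift i)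
            (subst (λ c → lookup c i ≢ 0) (sym wt-lift)
              (fixed i (Equivalence.from (wt≢0⇔appears S i) (x , sym eq)))))
      }
      where
      lift≤S : ∀ x → entry lift x ≤ entry S x
      lift≤S x = Equivalence.from (lift≤entry⇔ x x) ℕ.≤-refl

    lift-ASSF : IsASSF a lift
    lift-ASSF = ASSF-transfer sameOrder p lift-positive λ x col≡0 →
      trans (ℕ.≤-antisym (below x) (S≤lift x col≡0)) (first-column x col≡0)
      where
      open Coarsening lift-coarsening using (sameOrder; below; kept) renaming (cut to lift-cut)
      -- Some `y` has lifted entry `entry S x`, and `lift-cut` gives `entry S y ≤ entry S x`. As `x`
      -- is weakly left of `y`, a smaller lifted entry at `x` would force `entry S x < entry S y`.
      S≤lift : ∀ x → col x ≡ 0 → entry S x ≤ entry lift x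
      S≤lift x col≡0 with y , Ty≡Sx ← kept x = ℕ.≮⇒≥ λ Tx<Sx → ℕ.<⇒≱
        (Equivalence.from (sameOrder x y (subst (_≤ col y) (sym col≡0) z≤n))
          (subst (entry lift x <_) (sym Ty≡Sx) Tx<Sx))
        (lift-cut y x (ℕ.≤-reflexive Ty≡Sx))

  -- Merging values

  -- The values that are not merged into the next larger one.
  Break : Filling a → ℕ → Set
  Break T v = ∃[ z ] entry T z ≡ v × (col z ≡ 0 ⊎ (∃[ y ] IsUp T v (entry T y) × col z ≤ col y))

  break? : ∀ T → Decidable (Break T)
  break? T v = ∃ᶜ? λ z → (entry T z ≟ v) ×-dec ((col z ≟ 0) ⊎-dec
    (∃ᶜ? λ y → isUp? T v (entry T y) ×-dec (col z ≤? col y)))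

  NextBreak : Filling a → Cell a → ℕ → Set
  NextBreak T x k = entry T x ≤ k × Break T k

  nextBreak? : ∀ T x → Decidable (NextBreak T x)
  nextBreak? T x k = (entry T x ≤? k) ×-dec break? T k

  -- The bound `n` suffices for fillings in ASSF(a): the first entry of the row of `x` is a break,
  -- at least `entry T x` and at most `n`.
  merge : Filling a → Filling a
  merge T = build λ x → least (nextBreak? T x) n

  up-exists : ∀ (T : Filling a) {v} x → v < entry T x →
              ∃[ y ] IsUp T v (entry T y) × entry T y ≤ entry T x
  up-exists T {v} x v<Tx = y ,
    ((y , refl) , subst (v <_) (sym eq) (proj₁ sat) ,
      λ k app v<k → subst (_≤ k) (sym eq) (least-≤ P? (entry T x) (v<k , app))) ,
    subst (_≤ entry T x) (sym eq) (least-≤ P? (entry T x) (v<Tx , x , refl))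
    where
    P? : Decidable (λ k → v < k × Appears T k)
    P? k = (v <? k) ×-dec (∃ᶜ? λ y → entry T y ≟ k)
    sat = least-satisfies P? {m = entry T x} (v<Tx , x , refl) ℕ.≤-refl
    y = proj₁ (proj₂ sat)
    eq = proj₂ (proj₂ sat)

  leftmost-exists : ∀ (S : Filling a) x → ∃[ z ] entry S z ≡ entry S x × Leftmost S z
  leftmost-exists S x = z , Sz≡Sx , λ y Sy≡Sz →
    subst (_≤ col y) (sym colz) (least-≤ P? (col x) (y , trans Sy≡Sz Sz≡Sx , refl))
    where
    P? : Decidable (λ k → ∃[ z ] entry S z ≡ entry S x × col z ≡ k)
    P? k = ∃ᶜ? λ z → (entry S z ≟ entry S x) ×-dec (col z ≟ k)
    sat = least-satisfies P? {m = col x} (x , refl , refl) ℕ.≤-refl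
    z = proj₁ sat
    Sz≡Sx = proj₁ (proj₂ sat)
    colz = proj₂ (proj₂ sat)

  module Merge {T : Filling a} (p : IsASSF a T) where
    open IsASSF p

    row-start : ∀ x → ∃[ z ] col z ≡ 0 × entry T x ≤ entry T z
    row-start x@(cell i c) with c₀ , c₀≡0 ← leftmost-in-row c =
      cell i c₀ , c₀≡0 , rows-decreasing (cell i c₀) x refl (subst (_≤ toℕ c) (sym c₀≡0) z≤n)

    merge-nextBreak : ∀ x → NextBreak T x (entry (merge T) x)
    merge-nextBreak x with z , z≡0 , Tx≤Tz ← row-start x =
      subst (NextBreak T x) (sym (entry-build _ x))
        (least-satisfies (nextBreak? T x) (Tx≤Tz , z , refl , inj₁ z≡0) (ASSF-bounded p z))

    merge-least : ∀ x {k} → Break T k → entry T x ≤ k → entry (merge T) x ≤ k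
    merge-least x brk Tx≤k =
      subst (_≤ _) (sym (entry-build _ x)) (least-≤ (nextBreak? T x) n (Tx≤k , brk))

    T≤merge : ∀ x → entry T x ≤ entry (merge T) x
    T≤merge x = proj₁ (merge-nextBreak x)

    merge-break : ∀ x → Break T (entry (merge T) x)
    merge-break x = proj₂ (merge-nextBreak x)

    -- If `v` is not a break, every cell with the next larger value lies strictly left of every cell
    -- with value `v`. Climbing from `entry T x` to `entry T y` through non-breaks therefore moves
    -- strictly left at each step; `d` bounds the number of steps.
    no-break⇒right : ∀ d x y → entry T y ≤ d + entry T x → entry T x < entry T y →
                     (∀ k → Break T k → entry T x ≤ k → entry T y ≤ k) → col y < col x
    no-break⇒right zero    x y Ty≤ Tx<Ty _  = contradiction Ty≤ (ℕ.<⇒≱ Tx<Ty)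
    no-break⇒right (suc d) x y Ty≤ Tx<Ty nb with up-exists T y Tx<Ty
    ... | q , up@(_ , Tx<Tq , _) , Tq≤Ty with ℕ.m≤n⇒m<n∨m≡n Tq≤Ty
    ...   | inj₂ Tq≡Ty = next y (subst (IsUp T (entry T x)) Tq≡Ty up)
      where
      next : ∀ q → IsUp T (entry T x) (entry T q) → col q < col x
      next q up = ℕ.≰⇒> λ x≤q → ℕ.<⇒≱ Tx<Ty (nb _ (x , refl , inj₂ (q , up , x≤q)) ℕ.≤-refl)
    ...   | inj₁ Tq<Ty = ℕ.<-trans
      (no-break⇒right d q y
        (ℕ.≤-trans Ty≤ (ℕ.≤-trans (ℕ.≤-reflexive (sym (ℕ.+-suc d _))) (ℕ.+-monoʳ-≤ d Tx<Tq)))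
        Tq<Ty (λ k brk Tq≤k → nb k brk (ℕ.≤-trans (ℕ.<⇒≤ Tx<Tq) Tq≤k)))
      (ℕ.≰⇒> λ x≤q → ℕ.<⇒≱ Tx<Ty (nb _ (x , refl , inj₂ (q , up , x≤q)) ℕ.≤-refl))

    merge-cut : ∀ x y → entry T x ≤ entry (merge T) y → entry (merge T) x ≤ entry (merge T) y
    merge-cut x y = merge-least x (merge-break y)

    merge-coarsening : Coarsening T (merge T)
    merge-coarsening = record
      { sameOrder = λ x y x≤y → mk⇔
          (λ Sx<Sy → ℕ.≰⇒> λ Ty≤Tx → ℕ.<⇒≱ Sx<Sy (merge-cut y x (ℕ.≤-trans Ty≤Tx (T≤merge x))))
          -- Equal or reversed merged entries mean that no break `k` satisfies
          -- `entry T x ≤ k < entry T y`, so `y` would lie strictly left of `x`.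
          (λ Tx<Ty → ℕ.≰⇒> λ Sy≤Sx → ℕ.≤⇒≯ x≤y
            (no-break⇒right (entry T y) x y (ℕ.m≤m+n _ _) Tx<Ty λ k brk Tx≤k →
              ℕ.≤-trans (T≤merge y) (ℕ.≤-trans Sy≤Sx (merge-least x brk Tx≤k))))
      ; below     = T≤merge
      ; cut       = merge-cut
      ; kept      = λ x → let z , Tz≡ , _ = merge-break x in z , Tz≡
      }

    merge-ASSF : IsASSF a (merge T)
    merge-ASSF = ASSF-transfer
      (sameOrder-sym {merge T} {T} (Coarsening.sameOrder merge-coarsening)) p
      (λ x → ℕ.<-≤-trans (positive x) (T≤merge x))
      -- A first-column value is a break, so merging leaves it unchanged.
      (λ x x≡0 → trans
        (ℕ.≤-antisym (merge-least x (x , refl , inj₁ x≡0) ℕ.≤-refl) (T≤merge x))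
        (first-column x x≡0))

    -- The cell `z` witnessing the break keeps its value, so the leftmost occurrence is weakly left
    -- of `z`. The cell `y` carrying the next value of `T` also carries the next value of `merge T`,
    -- since values above the break only rise to later breaks.
    merge-particleHighest : ParticleHighest (merge T)
    merge-particleHighest x leftmost with merge-break x
    ... | z , Tz≡Sx , right = weaken right
      where
      S = merge T
      Sz≡Sx : entry S z ≡ entry S x
      Sz≡Sx = ℕ.≤-antisym
        (merge-cut z x (ℕ.≤-reflexive Tz≡Sx)) (subst (_≤ entry S z) Tz≡Sx (T≤merge z))
      x≤z : col x ≤ col z
      x≤z = leftmost z Sz≡Sx
      weaken : (col z ≡ 0 ⊎ (∃[ y ] IsUp T (entry S x) (entry T y) × col z ≤ col y)) →
               col x ≡ 0 ⊎ (∃[ y ] IsUp S (entry S x) (entry S y) × col x ≤ col y)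
      weaken (inj₁ z≡0) = inj₁ (ℕ.n≤0⇒n≡0 (subst (col x ≤_) z≡0 x≤z))
      weaken (inj₂ (y , (_ , Sx<Ty , minimal) , z≤y)) = inj₂ (y ,
        ((y , refl) , ℕ.<-≤-trans Sx<Ty (T≤merge y) , λ { _ (k , refl) Sx<Sk →
          merge-cut y k (ℕ.≤-trans
            (minimal _ (k , refl) (ℕ.≰⇒> (ℕ.<⇒≱ Sx<Sk ∘ merge-cut k x))) (T≤merge k)) }) ,
        ℕ.≤-trans x≤z z≤y)

  -- The breaks of `T` are exactly the values of `S`, and both `merge T` and `S` round each entry of
  -- `T` up to the nearest of these.
  merge-unique : ∀ {T S} → IsASSF a T → IsHSSF a S → Coarsening T S → merge T ≡ S
  merge-unique {T} {S} p (q , highest) T→S = entry-injective (merge T) S λ x → ℕ.≤-antisym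
    (merge-least x (value⇒break x) (below x))
    (let z , Sz≡ = break⇒value (merge-break x) in
      subst (entry S x ≤_) Sz≡ (cut x z (subst (entry T x ≤_) (sym Sz≡) (T≤merge x))))
    where
    open Coarsening T→S
    open Merge p

    break⇒value : ∀ {v} → Break T v → Appears S v
    break⇒value (z , refl , inj₁ z≡0) =
      z , trans (IsASSF.first-column q z z≡0) (sym (IsASSF.first-column p z z≡0))
    -- If `z` were raised, `entry S z` would be a value of `T` at least `entry T y`, so `cut` would
    -- give `entry S y ≤ entry S z`, against the order of `z` and `y`.
    break⇒value (z , refl , inj₂ (y , (_ , Tz<Ty , minimal) , z≤y)) = z , ℕ.≤-antisym
      (ℕ.≮⇒≥ λ Tz<Sz → ℕ.<⇒≱ (Equivalence.from (sameOrder z y z≤y) Tz<Ty)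
        (cut y z (minimal _ (kept z) Tz<Sz)))
      (below z)

    value⇒break : ∀ x → Break T (entry S x)
    value⇒break x with z , Sz≡Sx , leftmost ← leftmost-exists S x | y₀ , Ty₀≡Sx ← kept x =
      subst (Break T) Sz≡Sx (z , Tz≡Sz , right (highest z leftmost))
      where
      Sy₀≡Sz : entry S y₀ ≡ entry S z
      Sy₀≡Sz = trans
        (ℕ.≤-antisym (cut y₀ x (ℕ.≤-reflexive Ty₀≡Sx)) (subst (_≤ entry S y₀) Ty₀≡Sx (below y₀)))
        (sym Sz≡Sx)
      -- The cell `y₀` has this value in both fillings and `z` is weakly left of it, so a smaller
      -- `entry T z` would separate them in `S`.
      Tz≡Sz : entry T z ≡ entry S z
      Tz≡Sz = ℕ.≤-antisym (below z) (ℕ.≮⇒≥ λ Tz<Sz → ℕ.<-irrefl (sym Sy₀≡Sz)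
        (Equivalence.from (sameOrder z y₀ (leftmost y₀ Sy₀≡Sz))
          (subst (entry T z <_) (trans Sz≡Sx (sym Ty₀≡Sx)) Tz<Sz)))
      right : (col z ≡ 0 ⊎ (∃[ y ] IsUp S (entry S z) (entry S y) × col z ≤ col y)) →
              col z ≡ 0 ⊎ (∃[ y ] IsUp T (entry S z) (entry T y) × col z ≤ col y)
      right (inj₁ z≡0) = inj₁ z≡0
      right (inj₂ (y , (_ , Sz<Sy , minimal) , z≤y))
        with up-exists T y (ℕ.≰⇒> (ℕ.<⇒≱ Sz<Sy ∘ cut y z))
      ... | w , up , Tw≤Ty with ℕ.m≤n⇒m<n∨m≡n Tw≤Ty
      ...   | inj₂ Tw≡Ty = inj₂ (y , subst (IsUp T (entry S z)) Tw≡Ty up , z≤y)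
      -- Here `w` must lie strictly right of `y`: otherwise `entry S w < entry S y`, while
      -- `entry S w` exceeds `entry S z` and so is at least the next value `entry S y`.
      ...   | inj₁ Tw<Ty = inj₂ (w , up , ℕ.≤-trans z≤y (ℕ.<⇒≤ (ℕ.≰⇒> λ w≤y →
        ℕ.<⇒≱ (Equivalence.from (sameOrder w y w≤y) Tw<Ty)
          (minimal _ (w , refl) (ℕ.<-≤-trans (proj₁ (proj₂ up)) (below w))))))

-- The bijection and the identity

module _ {n : ℕ} (a : WeakComposition n) where

  mergeWithWeight : Filling a → Filling a × WeakComposition n
  mergeWithWeight T = merge T , wt T

  -- Both fillings have the reading order of their common merge, and order and weight determine a
  -- filling.
  mergeWithWeight-injective : ∀ {T U} → T ∈ elements (ASSF a) → U ∈ elements (ASSF a) →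
                              mergeWithWeight T ≡ mergeWithWeight U → T ≡ U
  mergeWithWeight-injective {T} {U} T∈ U∈ eq = sameOrder∧wt⇒≡ p q T~U (cong proj₂ eq)
    where
    p = sound (ASSF a) T∈
    q = sound (ASSF a) U∈
    T~U : SameOrder T U
    T~U = sameOrder-trans {S = T} {merge T} {U}
      (sameOrder-sym {S = merge T} {T} (Coarsening.sameOrder (Merge.merge-coarsening p)))
      (subst (λ S → SameOrder S U) (sym (cong proj₁ eq))
        (Coarsening.sameOrder (Merge.merge-coarsening q)))

  mergeWithWeight-image : ∀ {Se} → Se ∈ List.map mergeWithWeight (elements (ASSF a)) ⇔
                          Se ∈ pairs (elements (HSSF a)) (elements ∘ FS ∘ wt)
  mergeWithWeight-image = mk⇔ to from
    where
    to : ∀ {Se} → Se ∈ _ → Se ∈ _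
    to Se∈ with T , T∈ , refl ← ∈.∈-map⁻ mergeWithWeight Se∈ = ∈-pairs⁺ (elements ∘ FS ∘ wt)
      (complete (HSSF a) (merge-ASSF , merge-particleHighest))
      (complete (FS (wt (merge T)))
        (slide⇒fixedSlide _ _ (coarsening⇒slide p merge-ASSF merge-coarsening)))
      where
      p = sound (ASSF a) T∈
      open Merge p

    from : ∀ {Se} → Se ∈ _ → Se ∈ _
    from {S , e} Se∈ with S∈ , e∈ ← ∈-pairs⁻ (elements ∘ FS ∘ wt) Se∈ =
      subst (_∈ List.map mergeWithWeight (elements (ASSF a)))
        (cong₂ _,_ (merge-unique lift-ASSF q lift-coarsening) wt-lift)
        (∈.∈-map⁺ mergeWithWeight (complete (ASSF a) lift-ASSF))
      where
      q = sound (HSSF a) S∈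
      open Lift (proj₁ q) (fixedSlide⇒slide (sound (FS (wt S)) e∈))

theorem4p17 : (n : ℕ) (a : WeakComposition n) → 𝒜 a ≈ (∑[ S ∈ HSSF a ] 𝔏 (wt S))
theorem4p17 n a e = begin
  coeff (𝒜 a) e
    -- Labelling each term by `merge T` turns the left side into a sum over pairs.
    ≡⟨ cong (λ p → coeff p e) (∑-monomials (ASSF a) wt merge) ⟩
  coeff (monomials (List.map (mergeWithWeight a) (elements (ASSF a)))) e
    ≡⟨ coeff-↭ (↭.map⁺ _ (unique∧set⇒↭
         (map-unique (mergeWithWeight a) (mergeWithWeight-injective a) (unique (ASSF a)))
         (pairs-unique (elements ∘ FS ∘ wt) (unique (HSSF a)) (λ S → unique (FS (wt S))))
         (mergeWithWeight-image a))) e ⟩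
  coeff (monomials (pairs (elements (HSSF a)) (elements ∘ FS ∘ wt))) e
    ≡⟨ cong (λ p → coeff p e) (∑∑-monomials (HSSF a) (FS ∘ wt)) ⟨
  coeff (∑[ S ∈ HSSF a ] 𝔏 (wt S)) e ∎
  where open ≡-Reasoning
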